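{- Let $p$ be an odd prime and $r\in\{1,2,\ldots,(p-1)/2\}$. Then $$\sum_{k=0}^{\frac{p-1}2}\frac{\binom{2k}k^2}{32^k}k(k-1)\cdots(k-r+1)\equiv\begin{cases}0\pmod{p^2}&\text{if }4\mid(p+1-2r),\\ (-1)^{\frac{p-1+2r}4}2^{ -\frac{p-1}2}\dfrac{(\frac{p-1}2+r)!}{(\frac{p-1-2r}4)!\,(\frac{p-1+2r}4)!}\pmod{p^2}&\text{if }4\mid(p-1-2r).\end{cases}$$
   Context: Congruences are between rational numbers whose denominators are prime to $p$. -}

module Defs where

open import Data.Nat.Base as ℕ using (ℕ; zero; suc; _!)
open import Data.Nat.Properties using (m^n≢0; m*n≢0; _!*_!≢0)
open import Data.Nat.Combinatorics using (_C_; _P_)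
open import Data.Nat.Coprimality using (Coprime)
open import Data.Integer.Base as ℤ using (+_; -1ℤ)
import Data.Integer.Divisibility as ℤ
open import Data.Rational.Base using (ℚ; _/_; _+_; _-_; ↥_; ↧ₙ_)

-- x ≡ y (mod p ^ e) for rationals whose denominators are prime to p.
-- Values of ℚ are in lowest terms, so ↥_ and ↧ₙ_ are the reduced numerator
-- and denominator.
record Congruent (p e : ℕ) (x y : ℚ) : Set where
  constructor congruent
  field
    denominatorˡ-prime-to-p : Coprime (↧ₙ x) p
    denominatorʳ-prime-to-p : Coprime (↧ₙ y) p
    difference-divisible    : + (p ℕ.^ e) ℤ.∣ ↥ (x - y)

-- f 0 + f 1 + ⋯ + f n, with both end points included.
∑₀ : ℕ → (ℕ → ℚ) → ℚ
∑₀ zero    f = f 0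
∑₀ (suc n) f = ∑₀ n f + f (suc n)

-- k P r is the library's falling factorial k (k - 1) ⋯ (k - r + 1); it is 0
-- when k < r, where the product has a zero factor.
summand : ℕ → ℕ → ℚ
summand r k = + (((2 ℕ.* k) C k) ℕ.^ 2 ℕ.* (k P r)) / (32 ℕ.^ k)
  where instance _ = m^n≢0 32 k

lhs : ℕ → ℕ → ℚ
lhs p r = ∑₀ ((p ℕ.∸ 1) ℕ./ 2) (summand r)

-- The factor 2 ^ (-(p - 1)/2) appears in the denominator.  The subtractions
-- and the divisions by 4 are exact when p is odd, 2 r ≤ p - 1 and
-- 4 ∣ p - 1 - 2 r, the only case in which this value is meant to be used.
rhs : ℕ → ℕ → ℚ
rhs p r = (-1ℤ ℤ.^ b ℤ.* + ((h ℕ.+ r) !)) / (2 ℕ.^ h ℕ.* (a ! ℕ.* b !))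
  where
  h = (p ℕ.∸ 1) ℕ./ 2
  a = (p ℕ.∸ 1 ℕ.∸ 2 ℕ.* r) ℕ./ 4
  b = (p ℕ.∸ 1 ℕ.+ 2 ℕ.* r) ℕ./ 4
  instance
    _ = m*n≢0 (2 ℕ.^ h) (a ! ℕ.* b !) {{m^n≢0 2 h}} {{a !* b !≢0}}

{-# OPTIONS --safe #-}

-- Put p = 2n + 1.  Since (2n - 2k)(2n + 2k + 2) = p² - (2k + 1)², one has
-- C(2k,k) ≡ (-16)ᵏ C(n+k,2k) modulo p² for k ≤ n, so the sum is congruent to
-- ∑ₖ C(n+k,2k) C(2k,k) (-1/2)ᵏ k (k - 1) ⋯ (k - r + 1), which is (-1)ʳ times the
-- r-th derivative at 0 of the Legendre polynomial Pₙ.  Legendre's differential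
-- equation turns into a two-step recurrence in r with nonzero coefficients, and
-- descending from r = n + 1 and r = n it gives the two closed forms.
module Submission where

open import Defs

module LegendreAtZero where

  open import Data.Bool.Base using (true; false; T)
  open import Data.Nat.Base as ℕ using (ℕ; zero; suc; _!; z≤n; s≤s)
  import Data.Nat.Properties as ℕ
  import Data.Nat.Divisibility as ℕ
  import Data.Nat.DivMod as ℕ
  import Data.Nat.Tactic.RingSolver as ℕ-Solver
  open import Data.Nat.Combinatorics using (_C_; _P_; nC1≡n; nCn≡1; nPn≡n!; k>n⇒nCk≡0;
    k>n⇒nPk≡0; nCk+nC[k+1]≡[n+1]C[k+1]; nCk≡n!/k![n-k]!; k![n∸k]!∣n!)
  open import Data.Nat.Combinatorics.Base using (_P′_)
  open import Data.Nat.Combinatorics.Specification using (nP′k≡n[n∸1P′k∸1])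
  open import Data.Nat.Coprimality as Coprime using (Coprime; coprime-divisor; prime⇒coprime; 1-coprimeTo)
  open import Data.Nat.Primality using (Prime)
  open import Data.Integer.Base as ℤ using (ℤ; +_; 0ℤ; 1ℤ; -1ℤ; _+_; _*_; _-_; -_; _^_)
  open import Data.Integer.Properties as ℤ using (pos-*; pos-+)
  open import Data.Integer.Divisibility.Signed
  open import Data.Integer.GCD using (gcd; gcd[i,j]∣j)
  open import Data.Integer.Tactic.RingSolver using (solve-∀)
  open import Data.Product.Base using (∃; _,_)
  open import Data.Rational.Base as ℚ using (ℚ; _/_; 0ℚ; ↥_; ↧ₙ_; toℚᵘ)
  import Data.Rational.Properties as ℚ
  open import Data.Rational.Unnormalised.Base as ℚᵘ using (mkℚᵘ; *≡*)
  import Data.Rational.Unnormalised.Properties as ℚᵘ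
  open import Function.Base using (_$_)
  open import Relation.Binary.PropositionalEquality
  open import Relation.Nullary using (¬_; yes; no; contradiction)

  -- Binomial coefficients and their ratios.

  -- Induction through Pascal's rule: it splits the left side into two absorptions one row lower and
  -- reassembles the right side from them.
  C-absorb : ∀ n k → suc k ℕ.* (suc n C suc k) ≡ suc n ℕ.* (n C k)
  C-absorb n       zero    = trans (ℕ.*-identityˡ _) (trans (nC1≡n (suc n)) (sym (ℕ.*-identityʳ _)))
  C-absorb zero    (suc k) = trans (cong (suc (suc k) ℕ.*_) (k>n⇒nCk≡0 {1} {suc (suc k)} (s≤s (s≤s z≤n))))
      (ℕ.*-zeroʳ (suc (suc k)))
  C-absorb (suc n) (suc k) = begin
    suc (suc k) ℕ.* (suc (suc n) C suc (suc k))
      ≡⟨ cong (suc (suc k) ℕ.*_) (nCk+nC[k+1]≡[n+1]C[k+1] (suc n) (suc k)) ⟨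
    suc (suc k) ℕ.* (x ℕ.+ (suc n C suc (suc k)))
      ≡⟨ ℕ.*-distribˡ-+ (suc (suc k)) x _ ⟩
    (x ℕ.+ suc k ℕ.* x) ℕ.+ suc (suc k) ℕ.* (suc n C suc (suc k))
      ≡⟨ cong₂ (λ u v → (x ℕ.+ u) ℕ.+ v) (C-absorb n k) (C-absorb n (suc k)) ⟩
    (x ℕ.+ suc n ℕ.* (n C k)) ℕ.+ suc n ℕ.* (n C suc k)
      ≡⟨ ℕ.+-assoc x _ _ ⟩
    x ℕ.+ (suc n ℕ.* (n C k) ℕ.+ suc n ℕ.* (n C suc k))
      ≡⟨ cong (x ℕ.+_) (ℕ.*-distribˡ-+ (suc n) (n C k) (n C suc k)) ⟨
    x ℕ.+ suc n ℕ.* (n C k ℕ.+ n C suc k)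
      ≡⟨ cong (λ u → x ℕ.+ suc n ℕ.* u) (nCk+nC[k+1]≡[n+1]C[k+1] n k) ⟩
    suc (suc n) ℕ.* x ∎
    where
    open ≡-Reasoning
    x = suc n C suc k

  C-absorbᶻ : ∀ n k → + suc k * + (suc n C suc k) ≡ + suc n * + (n C k)
  C-absorbᶻ n k = trans (sym (pos-* (suc k) _)) (trans (cong +_ (C-absorb n k)) (pos-* (suc n) _))

  -- Pascal's rule subtracted from absorption. Over the integers the factor n - k may be negative,
  -- so no bound on k is assumed.
  C-step : ∀ n k → + suc k * + (n C suc k) ≡ (+ n - + k) * + (n C k)
  C-step n k = begin
    + suc k * x                        ≡⟨ isolate (+ k) (+ (n C k)) x ⟩
    + suc k * (+ (n C k) + x) - + suc k * + (n C k)
      ≡⟨ cong (λ u → + suc k * u - + suc k * + (n C k)) (trans (sym (pos-+ (n C k) _)) (cong +_ (nCk+nC[k+1]≡[n+1]C[k+1] n k))) ⟩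
    + suc k * + (suc n C suc k) - + suc k * + (n C k)
      ≡⟨ cong (_- + suc k * + (n C k)) (C-absorbᶻ n k) ⟩
    + suc n * + (n C k) - + suc k * + (n C k)
      ≡⟨ collect (+ n) (+ k) (+ (n C k)) ⟩
    (+ n - + k) * + (n C k) ∎
    where
    open ≡-Reasoning
    x = + (n C suc k)
    isolate : ∀ k y x → (1ℤ + k) * x ≡ (1ℤ + k) * (y + x) - (1ℤ + k) * y
    isolate = solve-∀
    collect : ∀ n k y → (1ℤ + n) * y - (1ℤ + k) * y ≡ (n - k) * y
    collect = solve-∀

  central : ℕ → ℤ
  central k = + ((2 ℕ.* k) C k)

  2*suc : ∀ k → 2 ℕ.* suc k ≡ suc (suc (2 ℕ.* k))
  2*suc = ℕ.*-suc 2

  -- Two absorptions lead from row 2k + 2 to row 2k. Between them C(2k+1,k) has to be exchanged for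
  -- C(2k+1,k+1), which costs a factor k + 1 on both sides that is cancelled at the end.
  central-step : ∀ k → + suc k * central (suc k) ≡ + 2 * (1ℤ + + 2 * + k) * central k
  central-step k = ℤ.*-cancelˡ-≡ (+ suc k) _ _ $ begin
    + suc k * (+ suc k * central (suc k))
      ≡⟨ cong (λ m → + suc k * (+ suc k * + (m C suc k))) (2*suc k) ⟩
    + suc k * (+ suc k * + (suc (suc (2 ℕ.* k)) C suc k))
      ≡⟨ cong (+ suc k *_) (C-absorbᶻ (suc (2 ℕ.* k)) k) ⟩
    + suc k * (+ suc (suc (2 ℕ.* k)) * y)
      ≡⟨ cong (λ m → + suc k * ((+ 2 + m) * y)) (pos-* 2 k) ⟩
    + suc k * ((+ 2 + + 2 * + k) * y)
      -- With k + 1 written as (2k + 1) - k, `C-step` performs the exchange.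
      ≡⟨ rearrange₁ (+ k) y ⟩
    + 2 * (+ suc k * ((1ℤ + + 2 * + k - + k) * y))
      ≡⟨ cong (λ m → + 2 * (+ suc k * ((1ℤ + m - + k) * y))) (pos-* 2 k) ⟨
    + 2 * (+ suc k * ((+ suc (2 ℕ.* k) - + k) * y))
      ≡⟨ cong (λ u → + 2 * (+ suc k * u)) (C-step (suc (2 ℕ.* k)) k) ⟨
    + 2 * (+ suc k * (+ suc k * + (suc (2 ℕ.* k) C suc k)))
      ≡⟨ cong (λ u → + 2 * (+ suc k * u)) (C-absorbᶻ (2 ℕ.* k) k) ⟩
    + 2 * (+ suc k * ((1ℤ + + (2 ℕ.* k)) * central k))
      ≡⟨ cong (λ m → + 2 * (+ suc k * ((1ℤ + m) * central k))) (pos-* 2 k) ⟩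
    + 2 * (+ suc k * ((1ℤ + + 2 * + k) * central k))
      ≡⟨ rearrange₂ (+ k) (central k) ⟩
    + suc k * (+ 2 * (1ℤ + + 2 * + k) * central k) ∎
    where
    open ≡-Reasoning
    y = + (suc (2 ℕ.* k) C k)
    rearrange₁ : ∀ k y → (1ℤ + k) * ((+ 2 + + 2 * k) * y) ≡ + 2 * ((1ℤ + k) * ((1ℤ + + 2 * k - k) * y))
    rearrange₁ = solve-∀
    rearrange₂ : ∀ k y → + 2 * ((1ℤ + k) * ((1ℤ + + 2 * k) * y)) ≡ (1ℤ + k) * (+ 2 * (1ℤ + + 2 * k) * y)
    rearrange₂ = solve-∀

  shifted : ℕ → ℕ → ℤ
  shifted n k = + ((n ℕ.+ k) C (2 ℕ.* k))

  -- Absorption lowers both indices of C(n+k+1,2k+2), then `C-step` lowers 2k + 1 to 2k with the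
  -- factor (n + k) - 2k = n - k.
  shifted-step : ∀ n k → (1ℤ + + 2 * + k) * (+ 2 + + 2 * + k) * shifted n (suc k)
      ≡ (+ n - + k) * (1ℤ + (+ n + + k)) * shifted n k
  shifted-step n k = begin
    (1ℤ + + 2 * + k) * (+ 2 + + 2 * + k) * shifted n (suc k)
      ≡⟨ ℤ.*-assoc (1ℤ + + 2 * + k) (+ 2 + + 2 * + k) _ ⟩
    (1ℤ + + 2 * + k) * ((+ 2 + + 2 * + k) * shifted n (suc k))
      ≡⟨ cong₂ (λ m l → (1ℤ + + 2 * + k) * ((+ 2 + + 2 * + k) * + (m C l))) (ℕ.+-suc n k) (2*suc k) ⟩
    (1ℤ + + 2 * + k) * ((+ 2 + + 2 * + k) * + (suc (n ℕ.+ k) C suc (suc (2 ℕ.* k))))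
      ≡⟨ cong (λ m → (1ℤ + m) * ((+ 2 + m) * + (suc (n ℕ.+ k) C suc (suc (2 ℕ.* k))))) (pos-* 2 k) ⟨
    + suc (2 ℕ.* k) * (+ suc (suc (2 ℕ.* k)) * + (suc (n ℕ.+ k) C suc (suc (2 ℕ.* k))))
      ≡⟨ cong (+ suc (2 ℕ.* k) *_) (C-absorbᶻ (n ℕ.+ k) (suc (2 ℕ.* k))) ⟩
    + suc (2 ℕ.* k) * (+ suc (n ℕ.+ k) * + ((n ℕ.+ k) C suc (2 ℕ.* k)))
      ≡⟨ swap (+ suc (2 ℕ.* k)) (+ suc (n ℕ.+ k)) _ ⟩
    + suc (n ℕ.+ k) * (+ suc (2 ℕ.* k) * + ((n ℕ.+ k) C suc (2 ℕ.* k)))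
      ≡⟨ cong (+ suc (n ℕ.+ k) *_) (C-step (n ℕ.+ k) (2 ℕ.* k)) ⟩
    + suc (n ℕ.+ k) * ((+ (n ℕ.+ k) - + (2 ℕ.* k)) * shifted n k)
      ≡⟨ cong (λ m → + suc (n ℕ.+ k) * ((+ (n ℕ.+ k) - m) * shifted n k)) (pos-* 2 k) ⟩
    (1ℤ + (+ n + + k)) * ((+ n + + k - + 2 * + k) * shifted n k)
      ≡⟨ collect (+ n) (+ k) (shifted n k) ⟩
    (+ n - + k) * (1ℤ + (+ n + + k)) * shifted n k ∎
    where
    open ≡-Reasoning
    swap : ∀ a b c → a * (b * c) ≡ b * (a * c)
    swap = solve-∀
    collect : ∀ n k y → (1ℤ + (n + k)) * ((n + k - + 2 * k) * y) ≡ (n - k) * (1ℤ + (n + k)) * y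
    collect = solve-∀

  -- Falling factorials over the integers.

  -- `_P_` first compares its arguments, while `_P′_` is a bare product; when the comparison fails,
  -- the factor `k ∸ r` of that product is already zero.
  P≡P′ : ∀ k r → k P r ≡ k P′ r
  P≡P′ k zero    = refl
  P≡P′ k (suc r) with suc r ℕ.≤ᵇ k in eq
  ... | true  = refl
  ... | false = sym (cong (ℕ._* (k P′ r)) (ℕ.m≤n⇒m∸n≡0 {k} {r} (ℕ.≮⇒≥ λ r<k → subst T eq (ℕ.≤⇒≤ᵇ r<k))))

  falling : ℕ → ℕ → ℤ
  falling k r = + (k P r)

  -- For r ≤ k the truncated factor `k ∸ r` equals the integer k - r; for r > k both falling
  -- factorials vanish, so the negative factor does no harm.
  falling-suc : ∀ k r → falling k (suc r) ≡ (+ k - + r) * falling k r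
  falling-suc k r with r ℕ.≤? k
  ... | yes r≤k = begin
    + (k P suc r)                     ≡⟨ cong +_ (P≡P′ k (suc r)) ⟩
    + ((k ℕ.∸ r) ℕ.* (k P′ r))        ≡⟨ pos-* (k ℕ.∸ r) _ ⟩
    + (k ℕ.∸ r) * + (k P′ r)          ≡⟨ cong₂ _*_ (trans (sym (ℤ.⊖-≥ r≤k)) (sym (ℤ.m-n≡m⊖n k r)))
        (cong +_ (sym (P≡P′ k r))) ⟩
    (+ k - + r) * + (k P r)           ∎
    where open ≡-Reasoning
  ... | no r≰k = trans (cong +_ (k>n⇒nPk≡0 {k} (ℕ.m<n⇒m<1+n k<r)))
                       (sym (trans (cong (λ x → (+ k - + r) * + x) (k>n⇒nPk≡0 {k} k<r)) (ℤ.*-zeroʳ (+ k - + r))))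
    where k<r = ℕ.≰⇒> r≰k

  -- Splits off the largest factor instead of the smallest; `telescope` uses this to relate falling
  -- factorials of m and m + 1.
  falling-suc-suc : ∀ k r → falling (suc k) (suc r) ≡ + suc k * falling k r
  falling-suc-suc k r = begin
    + (suc k P suc r)         ≡⟨ cong +_ (P≡P′ (suc k) (suc r)) ⟩
    + (suc k P′ suc r)        ≡⟨ cong +_ (nP′k≡n[n∸1P′k∸1] (suc k) (suc r)) ⟩
    + (suc k ℕ.* (k P′ r))    ≡⟨ pos-* (suc k) _ ⟩
    + suc k * + (k P′ r)      ≡⟨ cong (λ x → + suc k * + x) (P≡P′ k r) ⟨
    + suc k * + (k P r)       ∎
    where open ≡-Reasoning

  -- Integer sums over 0, ..., m.

  ∑ : ℕ → (ℕ → ℤ) → ℤ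
  ∑ zero    f = f 0
  ∑ (suc m) f = ∑ m f + f (suc m)

  ∑-cong : ∀ m {f g : ℕ → ℤ} → (∀ k → f k ≡ g k) → ∑ m f ≡ ∑ m g
  ∑-cong zero    eq = eq 0
  ∑-cong (suc m) eq = cong₂ _+_ (∑-cong m eq) (eq (suc m))

  ∑-+ : ∀ m f g → ∑ m (λ k → f k + g k) ≡ ∑ m f + ∑ m g
  ∑-+ zero    f g = refl
  ∑-+ (suc m) f g = trans (cong (_+ (f (suc m) + g (suc m))) (∑-+ m f g)) (interchange (∑ m f) (∑ m g) (f (suc m)) (g (suc m)))
    where
    interchange : ∀ a b c d → a + b + (c + d) ≡ a + c + (b + d)
    interchange = solve-∀

  ∑-*ˡ : ∀ m a f → ∑ m (λ k → a * f k) ≡ a * ∑ m f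
  ∑-*ˡ zero    a f = refl
  ∑-*ˡ (suc m) a f = trans (cong (_+ a * f (suc m)) (∑-*ˡ m a f)) (sym (ℤ.*-distribˡ-+ a _ _))

  ∑-zero : ∀ m {f} → (∀ k → k ℕ.≤ m → f k ≡ 0ℤ) → ∑ m f ≡ 0ℤ
  ∑-zero zero    eq = eq 0 ℕ.≤-refl
  ∑-zero (suc m) eq = cong₂ _+_ (∑-zero m λ k k≤m → eq k (ℕ.m≤n⇒m≤1+n k≤m)) (eq (suc m) ℕ.≤-refl)

  -- Legendre coefficients and the differential equation at 0.

  -- The Legendre polynomial is Pₙ(x) = 2⁻ⁿ ∑ₖ coeff n k (1 - x)ᵏ, because
  -- C(n+k,2k) C(2k,k) = C(n,k) C(n+k,k).
  coeff : ℕ → ℕ → ℤ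
  coeff n k = -1ℤ ^ k * + (2 ℕ.^ (n ℕ.∸ k)) * (shifted n k * central k)

  -- One factor k + 1 serves `central-step`; the other, together with the 2 (2k + 1) released there,
  -- serves `shifted-step`. The bound k < n makes 2^(n - k) twice 2^(n - k - 1) under truncated
  -- subtraction.
  coeff-step : ∀ n k → k ℕ.< n → + 2 * (+ suc k * + suc k) * coeff n (suc k)
      ≡ - ((+ n - + k) * (1ℤ + (+ n + + k)) * coeff n k)
  coeff-step n k k<n = begin
    + 2 * (+ suc k * + suc k) * (-1ℤ * s * t * (shifted n (suc k) * central (suc k)))
      ≡⟨ gather (+ k) s t (shifted n (suc k)) (central (suc k)) ⟩
    - (+ 2 * s * t * ((+ suc k * shifted n (suc k)) * (+ suc k * central (suc k))))
      ≡⟨ cong (λ u → - (+ 2 * s * t * ((+ suc k * shifted n (suc k)) * u))) (central-step k) ⟩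
    - (+ 2 * s * t * ((+ suc k * shifted n (suc k)) * (+ 2 * (1ℤ + + 2 * + k) * central k)))
      ≡⟨ shuffle (+ k) s t (shifted n (suc k)) (central k) ⟩
    - (s * (+ 2 * t) * (((1ℤ + + 2 * + k) * (+ 2 + + 2 * + k) * shifted n (suc k)) * central k))
      ≡⟨ cong₂ (λ u v → - (s * u * (v * central k))) 2t (shifted-step n k) ⟩
    - (s * + (2 ℕ.^ (n ℕ.∸ k)) * ((+ n - + k) * (1ℤ + (+ n + + k)) * shifted n k * central k))
      ≡⟨ pull s (+ (2 ℕ.^ (n ℕ.∸ k))) ((+ n - + k) * (1ℤ + (+ n + + k))) (shifted n k) (central k) ⟩
    - ((+ n - + k) * (1ℤ + (+ n + + k)) * coeff n k) ∎
    where
    open ≡-Reasoning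
    s = -1ℤ ^ k
    t = + (2 ℕ.^ (n ℕ.∸ suc k))
    2t : + 2 * t ≡ + (2 ℕ.^ (n ℕ.∸ k))
    2t = trans (sym (pos-* 2 (2 ℕ.^ (n ℕ.∸ suc k)))) (cong (λ m → + (2 ℕ.^ m)) (sym (ℕ.+-∸-assoc 1 k<n)))
    gather : ∀ k s t b v → + 2 * ((1ℤ + k) * (1ℤ + k)) * (-1ℤ * s * t * (b * v))
        ≡ - (+ 2 * s * t * (((1ℤ + k) * b) * ((1ℤ + k) * v)))
    gather = solve-∀
    shuffle : ∀ k s t b v → - (+ 2 * s * t * (((1ℤ + k) * b) * (+ 2 * (1ℤ + + 2 * k) * v)))
        ≡ - (s * (+ 2 * t) * (((1ℤ + + 2 * k) * (+ 2 + + 2 * k) * b) * v))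
    shuffle = solve-∀
    pull : ∀ s t q b v → - (s * t * (q * b * v)) ≡ - (q * (s * t * (b * v)))
    pull = solve-∀

  -- (-1)ʳ 2ⁿ times the r-th derivative of Pₙ at 0.
  derivative : ℕ → ℕ → ℤ
  derivative n r = ∑ n (λ k → coeff n k * falling k r)

  -- The Legendre equation applied term by term to the expansion in powers of 1 - x: the
  -- contributions telescope, and the boundary term carries a factor n - m that vanishes at m = n.
  telescope : ∀ n r m → m ℕ.≤ n →
    ∑ m (λ k → coeff n k * (falling k (2 ℕ.+ r) + (+ n - + r) * (1ℤ + (+ n + + r)) * falling k r))
      ≡ (+ n - + m) * (1ℤ + (+ n + + m)) * coeff n m * falling m r
  telescope n r zero _ = begin
    c * (falling 0 (2 ℕ.+ r) + q * x)
      ≡⟨ cong (λ u → c * (u + q * x)) (falling-suc 0 (suc r)) ⟩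
    c * ((0ℤ - + suc r) * falling 0 (suc r) + q * x)
      ≡⟨ cong (λ u → c * ((0ℤ - + suc r) * u + q * x)) (falling-suc 0 r) ⟩
    c * ((0ℤ - + suc r) * ((0ℤ - + r) * x) + q * x)
      -- This is (r + 1) r + (n - r) (n + r + 1) = n (n + 1).
      ≡⟨ collect (+ n) (+ r) c x ⟩
    (+ n - 0ℤ) * (1ℤ + (+ n + 0ℤ)) * c * x ∎
    where
    open ≡-Reasoning
    c = coeff n 0
    x = falling 0 r
    q = (+ n - + r) * (1ℤ + (+ n + + r))
    collect : ∀ n r c x → c * ((0ℤ - (1ℤ + r)) * ((0ℤ - r) * x) + (n - r) * (1ℤ + (n + r)) * x)
            ≡ (n - 0ℤ) * (1ℤ + (n + 0ℤ)) * c * x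
    collect = solve-∀
  telescope n r (suc m) m<n = begin
    ∑ m _ + c * (falling (suc m) (2 ℕ.+ r) + q * x)
      ≡⟨ cong (_+ c * (falling (suc m) (2 ℕ.+ r) + q * x)) (telescope n r m (ℕ.<⇒≤ m<n)) ⟩
    (+ n - + m) * (1ℤ + (+ n + + m)) * coeff n m * falling m r + c * (falling (suc m) (2 ℕ.+ r) + q * x)
      -- `coeff-step` read backwards expresses the boundary term at m through `coeff n (suc m)`.
      ≡⟨ cong (λ u → u * falling m r + c * (falling (suc m) (2 ℕ.+ r) + q * x))
          (trans (sym (ℤ.neg-involutive _)) (cong -_ (sym (coeff-step n m m<n)))) ⟩
    - (+ 2 * (+ suc m * + suc m) * c) * falling m r + c * (falling (suc m) (2 ℕ.+ r) + q * x)
      ≡⟨ gather (+ m) c (falling m r) _ ⟩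
    - (+ 2 * + suc m * c * (+ suc m * falling m r)) + c * (falling (suc m) (2 ℕ.+ r) + q * x)
      -- The remaining falling factorials become multiples of x, which leaves a polynomial identity
      -- in n, m and r.
      ≡⟨ cong₂ (λ u v → - (+ 2 * + suc m * c * u) + c * (v + q * x))
          (trans (sym (falling-suc-suc m r)) (falling-suc (suc m) r))
          (trans (falling-suc (suc m) (suc r)) (cong ((+ suc m - + suc r) *_) (falling-suc (suc m) r))) ⟩
    - (+ 2 * + suc m * c * ((+ suc m - + r) * x)) + c * ((+ suc m - + suc r) * ((+ suc m - + r) * x) + q * x)
      ≡⟨ collect (+ n) (+ m) (+ r) c x ⟩
    (+ n - + suc m) * (1ℤ + (+ n + + suc m)) * c * x ∎
    where
    open ≡-Reasoning
    c = coeff n (suc m)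
    x = falling (suc m) r
    q = (+ n - + r) * (1ℤ + (+ n + + r))
    gather : ∀ m c y z → - (+ 2 * ((1ℤ + m) * (1ℤ + m)) * c) * y + z ≡ - (+ 2 * (1ℤ + m) * c * ((1ℤ + m) * y)) + z
    gather = solve-∀
    collect : ∀ n m r c x →
      - (+ 2 * (1ℤ + m) * c * ((1ℤ + m - r) * x)) + c * ((1ℤ + m - (1ℤ + r)) * ((1ℤ + m - r) * x) + (n - r) * (1ℤ + (n + r)) * x)
        ≡ (n - (1ℤ + m)) * (1ℤ + (n + (1ℤ + m))) * c * x
    collect = solve-∀

  -- The Legendre equation (1 - x²) y″ - 2 x y′ + n (n + 1) y = 0, differentiated r
  -- times at x = 0.
  derivative-step : ∀ n r → derivative n (2 ℕ.+ r) ≡ - ((+ n - + r) * (1ℤ + (+ n + + r)) * derivative n r)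
  derivative-step n r = ℤ.i-j≡0⇒i≡j _ _ $ begin
    derivative n (2 ℕ.+ r) - - (q * derivative n r)
      ≡⟨ cong (λ u → derivative n (2 ℕ.+ r) + u) (ℤ.neg-involutive (q * derivative n r)) ⟩
    derivative n (2 ℕ.+ r) + q * derivative n r
      ≡⟨ cong (λ u → derivative n (2 ℕ.+ r) + u) (∑-*ˡ n q _) ⟨
    derivative n (2 ℕ.+ r) + ∑ n (λ k → q * (coeff n k * falling k r))
      ≡⟨ ∑-+ n _ _ ⟨
    ∑ n (λ k → coeff n k * falling k (2 ℕ.+ r) + q * (coeff n k * falling k r))
      ≡⟨ ∑-cong n (λ k → factor (coeff n k) (falling k (2 ℕ.+ r)) q (falling k r)) ⟩
    ∑ n (λ k → coeff n k * (falling k (2 ℕ.+ r) + q * falling k r))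
      ≡⟨ telescope n r n ℕ.≤-refl ⟩
    (+ n - + n) * (1ℤ + (+ n + + n)) * coeff n n * falling n r
      ≡⟨ vanish (+ n) (coeff n n) (falling n r) ⟩
    0ℤ ∎
    where
    open ≡-Reasoning
    q = (+ n - + r) * (1ℤ + (+ n + + r))
    factor : ∀ c y q x → c * y + q * (c * x) ≡ c * (y + q * x)
    factor = solve-∀
    vanish : ∀ n c x → (n - n) * (1ℤ + (n + n)) * c * x ≡ 0ℤ
    vanish = solve-∀

  -- Closed forms for the derivatives at 0.

  coeff*falling-vanishes : ∀ n {k r} → k ℕ.< r → coeff n k * falling k r ≡ 0ℤ
  coeff*falling-vanishes n {k} {r} k<r = trans (cong (λ x → coeff n k * + x) (k>n⇒nPk≡0 {k} {r} k<r)) (ℤ.*-zeroʳ (coeff n k))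

  -- For k < n the factor `falling k n` is zero, so only the term k = n survives.
  derivative-top : ∀ n → derivative n n ≡ coeff n n * + (n !)
  derivative-top zero      = refl
  derivative-top n@(suc m) = begin
    ∑ m (λ k → coeff n k * falling k n) + coeff n n * falling n n
      ≡⟨ cong₂ (λ x y → x + coeff n n * + y) (∑-zero m λ k k≤m → coeff*falling-vanishes n {k} {n} (s≤s k≤m)) (nPn≡n! n) ⟩
    0ℤ + coeff n n * + (n !)
      ≡⟨ ℤ.+-identityˡ _ ⟩
    coeff n n * + (n !) ∎
    where open ≡-Reasoning

  C*k!*[n∸k]! : ∀ {n k} → k ℕ.≤ n → (n C k) ℕ.* (k ! ℕ.* (n ℕ.∸ k) !) ≡ n !
  C*k!*[n∸k]! {n} {k} k≤n = trans (cong (ℕ._* (k ! ℕ.* (n ℕ.∸ k) !)) (nCk≡n!/k![n-k]! k≤n))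
      (ℕ.m/n*n≡m (k![n∸k]!∣n! k≤n))
    where instance _ = k ℕ.!* (n ℕ.∸ k) !≢0

  central*n!*n! : ∀ n → central n * (+ (n !) * + (n !)) ≡ + ((n ℕ.+ n) !)
  central*n!*n! n = begin
    central n * (+ (n !) * + (n !))            ≡⟨ cong (central n *_) (pos-* (n !) (n !)) ⟨
    central n * + (n ! ℕ.* n !)                ≡⟨ pos-* ((2 ℕ.* n) C n) (n ! ℕ.* n !) ⟨
    + (((2 ℕ.* n) C n) ℕ.* (n ! ℕ.* n !))      ≡⟨ cong (λ m → + ((m C n) ℕ.* (n ! ℕ.* n !))) 2n ⟩
    + (((n ℕ.+ n) C n) ℕ.* (n ! ℕ.* n !))      ≡⟨ cong (λ m → + (((n ℕ.+ n) C n) ℕ.* (n ! ℕ.* m !))) (ℕ.m+n∸n≡m n n) ⟨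
    + (((n ℕ.+ n) C n) ℕ.* (n ! ℕ.* (n ℕ.+ n ℕ.∸ n) !)) ≡⟨ cong +_ (C*k!*[n∸k]! (ℕ.m≤m+n n n)) ⟩
    + ((n ℕ.+ n) !) ∎
    where
    open ≡-Reasoning
    2n : 2 ℕ.* n ≡ n ℕ.+ n
    2n = cong (n ℕ.+_) (ℕ.+-identityʳ n)

  coeff-top : ∀ n → coeff n n ≡ -1ℤ ^ n * central n
  coeff-top n = begin
    -1ℤ ^ n * + (2 ℕ.^ (n ℕ.∸ n)) * (+ ((n ℕ.+ n) C (2 ℕ.* n)) * central n)
      ≡⟨ cong₂ (λ x y → -1ℤ ^ n * + (2 ℕ.^ x) * (+ y * central n))
          (ℕ.n∸n≡0 n)
          (trans (cong (λ m → (n ℕ.+ m) C (2 ℕ.* n)) (sym (ℕ.+-identityʳ n))) (nCn≡1 (2 ℕ.* n))) ⟩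
    -1ℤ ^ n * 1ℤ * (1ℤ * central n)
      ≡⟨ cong₂ _*_ (ℤ.*-identityʳ (-1ℤ ^ n)) (ℤ.*-identityˡ (central n)) ⟩
    -1ℤ ^ n * central n ∎
    where open ≡-Reasoning

  -- Naming n - r as `suc d` shows the coefficient to be nonzero, so that it can be cancelled when
  -- descending in r.
  derivative-step′ : ∀ {n r d} → n ≡ r ℕ.+ suc d →
      derivative n (2 ℕ.+ r) ≡ - (+ suc d * + suc (n ℕ.+ r) * derivative n r)
  derivative-step′ {r = r} {d} refl =
      trans (derivative-step n r) (cong (λ x → - (x * + suc (n ℕ.+ r) * derivative n r))
      (cancel (+ r) (+ suc d)))
    where
    n = r ℕ.+ suc d
    cancel : ∀ r d → r + d - r ≡ d
    cancel = solve-∀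

  -- The recurrence runs downwards from r = n + 1 here and from r = n in
  -- derivative-even.
  derivative-odd : ∀ {n} a r → r ℕ.+ 2 ℕ.* a ≡ suc n → derivative n r ≡ 0ℤ
  -- Here r = n + 1 exceeds every k in the sum.
  derivative-odd {n} zero r eq = ∑-zero n λ k k≤n → coeff*falling-vanishes n {k} {r}
      (subst (k ℕ.<_) (trans (sym eq) (ℕ.+-identityʳ r)) (s≤s k≤n))
  derivative-odd {n} (suc a) r eq =
    ℤ.*-cancelˡ-≡ (+ suc (2 ℕ.* a) * + suc (n ℕ.+ r)) (derivative n r) 0ℤ
        {{ℤ.i*j≢0 (+ suc (2 ℕ.* a)) (+ suc (n ℕ.+ r))}} $ begin
      + suc (2 ℕ.* a) * + suc (n ℕ.+ r) * derivative n r
        ≡⟨ ℤ.neg-injective (trans (sym (derivative-step′ {n} n≡)) (derivative-odd {n} a (2 ℕ.+ r) 2+r+2a≡)) ⟩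
      0ℤ
        ≡⟨ ℤ.*-zeroʳ (+ suc (2 ℕ.* a) * + suc (n ℕ.+ r)) ⟨
      + suc (2 ℕ.* a) * + suc (n ℕ.+ r) * 0ℤ ∎
    where
    open ≡-Reasoning
    shift : ∀ r a → 2 ℕ.+ r ℕ.+ 2 ℕ.* a ≡ r ℕ.+ 2 ℕ.* suc a
    shift = ℕ-Solver.solve-∀
    2+r+2a≡ : 2 ℕ.+ r ℕ.+ 2 ℕ.* a ≡ suc n
    2+r+2a≡ = trans (shift r a) eq
    n≡ : n ≡ r ℕ.+ suc (2 ℕ.* a)
    n≡ = trans (sym (ℕ.suc-injective 2+r+2a≡)) (sym (ℕ.+-suc r (2 ℕ.* a)))

  derivative-even : ∀ {n} a r → r ℕ.+ 2 ℕ.* a ≡ n →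
    derivative n r * (+ (a !) * + ((a ℕ.+ r) !)) ≡ -1ℤ ^ (a ℕ.+ r) * + ((n ℕ.+ r) !)
  derivative-even {n} zero r eq with trans (sym eq) (ℕ.+-identityʳ r)
  ... | refl = begin
    -- At r = n the value is (-1)ⁿ C(2n,n) n!, and C(2n,n) n!² = (2n)!.
    derivative n n * (1ℤ * + (n !))
      ≡⟨ cong (_* (1ℤ * + (n !))) (trans (derivative-top n) (cong (_* + (n !)) (coeff-top n))) ⟩
    -1ℤ ^ n * central n * + (n !) * (1ℤ * + (n !))
      ≡⟨ assoc (-1ℤ ^ n) (central n) (+ (n !)) ⟩
    -1ℤ ^ n * (central n * (+ (n !) * + (n !)))
      ≡⟨ cong (-1ℤ ^ n *_) (central*n!*n! n) ⟩
    -1ℤ ^ n * + ((n ℕ.+ n) !) ∎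
    where
    open ≡-Reasoning
    assoc : ∀ s c x → s * c * x * (1ℤ * x) ≡ s * (c * (x * x))
    assoc = solve-∀
  derivative-even {n} (suc a) r eq =
    -- Since n = r + 2 (a + 1), one has n + r + 2 = 2 u, so 2 u v is the ratio of (n + r + 2)! to (n
    -- + r)!. On the left, the factor (2a + 2) v moves the derivative from r to r + 2, and u raises
    -- (a + r + 1)! to (a + r + 2)!.
    ℤ.*-cancelˡ-≡ (+ 2 * u * v) _ _ {{ℤ.i*j≢0 (+ 2 * u) v {{ℤ.i*j≢0 (+ 2) u}}}} $ begin
      + 2 * u * v * (D * (+ (suc a !) * B))
        ≡⟨ cong (λ x → + 2 * u * v * (D * (x * B))) (pos-* (suc a) (a !)) ⟩
      + 2 * u * v * (D * (+ suc a * A * B))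
        ≡⟨ gather (+ a) u v D A B ⟩
      - (- ((+ 2 + + 2 * + a) * v * D) * (A * (u * B)))
        ≡⟨ cong (λ x → - (- ((+ 2 + x) * v * D) * (A * (u * B)))) (pos-* 2 a) ⟨
      - (- (+ suc (suc (2 ℕ.* a)) * v * D) * (A * (u * B)))
        ≡⟨ cong₂ (λ x y → - (x * (A * y))) (sym (derivative-step′ {n} n≡))
            (sym (pos-* (suc (suc (a ℕ.+ r))) (suc (a ℕ.+ r) !))) ⟩
      - (derivative n (2 ℕ.+ r) * (A * + (suc (suc (a ℕ.+ r)) !)))
        ≡⟨ cong (λ m → - (derivative n (2 ℕ.+ r) * (A * + (m !)))) (+-2+ a r) ⟨
      - (derivative n (2 ℕ.+ r) * (A * + ((a ℕ.+ (2 ℕ.+ r)) !)))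
        ≡⟨ cong -_ (derivative-even {n} a (2 ℕ.+ r) (trans (shift r a) eq)) ⟩
      - (-1ℤ ^ (a ℕ.+ (2 ℕ.+ r)) * + ((n ℕ.+ (2 ℕ.+ r)) !))
        ≡⟨ cong₂ (λ l m → - (-1ℤ ^ l * + (m !))) (+-2+ a r) (+-2+ n r) ⟩
      - (-1ℤ * (-1ℤ * s) * + (suc (suc (n ℕ.+ r)) !))
        ≡⟨ cong (λ x → - (-1ℤ * (-1ℤ * s) * x))
            (trans (pos-* (suc (suc (n ℕ.+ r))) (suc (n ℕ.+ r) !))
            (cong₂ _*_ n+r+2≡ (pos-* (suc (n ℕ.+ r)) ((n ℕ.+ r) !)))) ⟩
      - (-1ℤ * (-1ℤ * s) * (+ 2 * u * (v * N)))
        ≡⟨ signs s u v N ⟩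
      + 2 * u * v * (-1ℤ * s * N) ∎
    where
    open ≡-Reasoning
    D = derivative n r
    A = + (a !)
    B = + (suc (a ℕ.+ r) !)
    N = + ((n ℕ.+ r) !)
    s = -1ℤ ^ (a ℕ.+ r)
    u = + suc (suc (a ℕ.+ r))
    v = + suc (n ℕ.+ r)
    +-2+ : ∀ m l → m ℕ.+ (2 ℕ.+ l) ≡ suc (suc (m ℕ.+ l))
    +-2+ = ℕ-Solver.solve-∀
    shift : ∀ r a → 2 ℕ.+ r ℕ.+ 2 ℕ.* a ≡ r ℕ.+ 2 ℕ.* suc a
    shift = ℕ-Solver.solve-∀
    n≡ : n ≡ r ℕ.+ suc (suc (2 ℕ.* a))
    n≡ = trans (sym eq) (cong (r ℕ.+_) (2*suc a))
    double : ∀ r a → suc (suc (r ℕ.+ 2 ℕ.* suc a ℕ.+ r)) ≡ 2 ℕ.* suc (suc (a ℕ.+ r))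
    double = ℕ-Solver.solve-∀
    n+r+2≡ : + suc (suc (n ℕ.+ r)) ≡ + 2 * u
    n+r+2≡ = trans (cong +_ (trans (cong (λ m → suc (suc (m ℕ.+ r))) (sym eq)) (double r a))) (pos-* 2 (suc (suc (a ℕ.+ r))))
    gather : ∀ a u v D A B → + 2 * u * v * (D * ((1ℤ + a) * A * B)) ≡ - (- ((+ 2 + + 2 * a) * v * D) * (A * (u * B)))
    gather = solve-∀
    signs : ∀ s u v N → - (-1ℤ * (-1ℤ * s) * (+ 2 * u * (v * N))) ≡ + 2 * u * v * (-1ℤ * s * N)
    signs = solve-∀

  -- Coprimality and the congruence for central binomials.

  -- A common divisor of m and a b is coprime to a because m is, hence it divides b.
  coprime-* : ∀ {m a b} → Coprime m a → Coprime m b → Coprime m (a ℕ.* b)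
  coprime-* c₁ c₂ (d∣m , d∣ab) = c₂ (d∣m , coprime-divisor (λ (e∣d , e∣a) → c₁ (ℕ.∣-trans e∣d d∣m , e∣a)) d∣ab)

  coprime-^ : ∀ {m a} e → Coprime m a → Coprime m (a ℕ.^ e)
  coprime-^ {m} zero    c = Coprime.sym (1-coprimeTo m)
  coprime-^     (suc e) c = coprime-* c (coprime-^ e c)

  ∣ᶻ-cancel-coprime : ∀ {m} a {i} → Coprime m a → + m ∣ + a * i → + m ∣ i
  ∣ᶻ-cancel-coprime {m} a {i} c m∣ai = ∣ᵤ⇒∣ (coprime-divisor c (subst (m ℕ.∣_) (ℤ.abs-* (+ a) i) (∣⇒∣ᵤ m∣ai)))

  -- 4 (n - k) (n + k + 1) = p² - (2k + 1)² for p = 2n + 1, so modulo p² both sides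
  -- satisfy (2k + 1) (2k + 2) xₖ₊₁ = 4 (2k + 1)² xₖ.
  central≡shifted : ∀ n k → Prime (suc (2 ℕ.* n)) → k ℕ.≤ n →
    + (suc (2 ℕ.* n) ℕ.^ 2) ∣ central k - -1ℤ ^ k * + (16 ℕ.^ k) * shifted n k
  central≡shifted n zero    _     _   = divides 0ℤ refl
  central≡shifted n (suc k) p-prime k<n =
    -- Both 2k + 1 and 2k + 2 are at most 2n < p, so this factor is prime to p² and may be
    -- cancelled.
    ∣ᶻ-cancel-coprime (suc (2 ℕ.* k) ℕ.* suc (suc (2 ℕ.* k)))
      (Coprime.sym $ coprime-^ 2 $ Coprime.sym $ coprime-*
        (prime⇒coprime p-prime (s≤s (ℕ.≤-trans (ℕ.n≤1+n _) 2k+2≤2n)))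
        (prime⇒coprime p-prime (s≤s 2k+2≤2n))) $
    subst (+ (p ℕ.^ 2) ∣_) (sym expand) $
    -- The first summand is 4 (2k + 1)² times the difference of the induction hypothesis, the second
    -- a multiple of p².
    ∣m∣n⇒∣m+n (∣n⇒∣m*n (+ 4 * (1ℤ + + 2 * K) * (1ℤ + + 2 * K)) (central≡shifted n k p-prime (ℕ.<⇒≤ k<n)))
              (divides (+ 4 * g * B) (cong (+ 4 * g * B *_) (sym p²≡)))
    where
    open ≡-Reasoning
    p = suc (2 ℕ.* n)
    K = + k
    N = + n
    g = -1ℤ ^ k * + (16 ℕ.^ k)
    B = shifted n k
    V = central k
    2k+2≤2n : suc (suc (2 ℕ.* k)) ℕ.≤ 2 ℕ.* n
    2k+2≤2n = subst (ℕ._≤ 2 ℕ.* n) (2*suc k) (ℕ.*-monoʳ-≤ 2 k<n)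
    p²≡ : + (p ℕ.^ 2) ≡ (1ℤ + + 2 * N) * ((1ℤ + + 2 * N) * 1ℤ)
    p²≡ = trans (pos-* p (p ℕ.* 1)) (trans (cong (+ p *_) (pos-* p 1)) (cong (λ x → (1ℤ + x) * ((1ℤ + x) * 1ℤ)) (pos-* 2 n)))
    regroup : ∀ k s t B V → (1ℤ + + 2 * k) * (+ 2 + + 2 * k) * (V - -1ℤ * s * (+ 16 * t) * B)
      ≡ + 2 * (1ℤ + + 2 * k) * ((1ℤ + k) * V) + + 16 * (s * t) * ((1ℤ + + 2 * k) * (+ 2 + + 2 * k) * B)
    regroup = solve-∀
    complete : ∀ n k g B V → + 2 * (1ℤ + + 2 * k) * (+ 2 * (1ℤ + + 2 * k) * V) + + 16 * g * ((n - k) * (1ℤ + (n + k)) * B)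
      ≡ + 4 * (1ℤ + + 2 * k) * (1ℤ + + 2 * k) * (V - g * B) + + 4 * g * B * ((1ℤ + + 2 * n) * ((1ℤ + + 2 * n) * 1ℤ))
    complete = solve-∀
    expand : + (suc (2 ℕ.* k) ℕ.* suc (suc (2 ℕ.* k))) * (central (suc k) - -1ℤ ^ suc k * + (16 ℕ.^ suc k) * shifted n (suc k))
      ≡ + 4 * (1ℤ + + 2 * K) * (1ℤ + + 2 * K) * (V - g * B) + + 4 * g * B * ((1ℤ + + 2 * N) * ((1ℤ + + 2 * N) * 1ℤ))
    expand = begin
      + (suc (2 ℕ.* k) ℕ.* suc (suc (2 ℕ.* k))) * (central (suc k) - -1ℤ ^ suc k * + (16 ℕ.^ suc k) * shifted n (suc k))
        ≡⟨ cong₂ (λ x y → x * (central (suc k) - -1ℤ ^ suc k * y * shifted n (suc k)))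
             (trans (pos-* (suc (2 ℕ.* k)) (suc (suc (2 ℕ.* k)))) (cong (λ x → (1ℤ + x) * (+ 2 + x)) (pos-* 2 k)))
                 (pos-* 16 (16 ℕ.^ k)) ⟩
      (1ℤ + + 2 * K) * (+ 2 + + 2 * K) * (central (suc k) - -1ℤ ^ suc k * (+ 16 * + (16 ℕ.^ k)) * shifted n (suc k))
        ≡⟨ regroup K (-1ℤ ^ k) (+ (16 ℕ.^ k)) (shifted n (suc k)) (central (suc k)) ⟩
      + 2 * (1ℤ + + 2 * K) * (+ suc k * central (suc k)) + + 16 * g * ((1ℤ + + 2 * K) * (+ 2 + + 2 * K) * shifted n (suc k))
        ≡⟨ cong₂ (λ x y → + 2 * (1ℤ + + 2 * K) * x + + 16 * g * y) (central-step k) (shifted-step n k) ⟩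
      + 2 * (1ℤ + + 2 * K) * (+ 2 * (1ℤ + + 2 * K) * V) + + 16 * g * ((N - K) * (1ℤ + (N + K)) * B)
        ≡⟨ complete N K g B V ⟩
      + 4 * (1ℤ + + 2 * K) * (1ℤ + + 2 * K) * (V - g * B) + + 4 * g * B * ((1ℤ + + 2 * N) * ((1ℤ + + 2 * N) * 1ℤ)) ∎

  ^-distribʳ-* : ∀ e a b → (a ℕ.* b) ℕ.^ e ≡ a ℕ.^ e ℕ.* b ℕ.^ e
  ^-distribʳ-* zero    a b = refl
  ^-distribʳ-* (suc e) a b = trans (cong (a ℕ.* b ℕ.*_) (^-distribʳ-* e a b)) (interchange a b (a ℕ.^ e) (b ℕ.^ e))
    where
    interchange : ∀ a b x y → a ℕ.* b ℕ.* (x ℕ.* y) ≡ a ℕ.* x ℕ.* (b ℕ.* y)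
    interchange = ℕ-Solver.solve-∀

  -- The congruence over a common denominator.

  -- For k ≤ n this is `summand r k` times 32ⁿ.
  numerator : ℕ → ℕ → ℕ → ℤ
  numerator n r k = + ((((2 ℕ.* k) C k) ℕ.^ 2 ℕ.* (k P r)) ℕ.* 32 ℕ.^ (n ℕ.∸ k))

  -- Only one of the two factors C(2k,k) is replaced by means of `central≡shifted`; the other stays
  -- and becomes part of `coeff`. The powers match because 32^(n - k) 16^k = 16^n 2^(n - k).
  numerator≡coeff : ∀ n r k → Prime (suc (2 ℕ.* n)) → k ℕ.≤ n →
    + (suc (2 ℕ.* n) ℕ.^ 2) ∣ numerator n r k - + (16 ℕ.^ n) * (coeff n k * falling k r)
  numerator≡coeff n r k p-prime k≤n =
    subst (+ (suc (2 ℕ.* n) ℕ.^ 2) ∣_) (sym difference) (∣n⇒∣m*n (V * F * X) (central≡shifted n k p-prime k≤n))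
    where
    open ≡-Reasoning
    V = central k
    F = falling k r
    X = + (32 ℕ.^ (n ℕ.∸ k))
    Y = + (2 ℕ.^ (n ℕ.∸ k))
    s = -1ℤ ^ k
    B = shifted n k
    powers : 32 ℕ.^ (n ℕ.∸ k) ℕ.* 16 ℕ.^ k ≡ 16 ℕ.^ n ℕ.* 2 ℕ.^ (n ℕ.∸ k)
    powers = begin
      32 ℕ.^ (n ℕ.∸ k) ℕ.* 16 ℕ.^ k
        ≡⟨ cong (ℕ._* 16 ℕ.^ k) (^-distribʳ-* (n ℕ.∸ k) 16 2) ⟩
      16 ℕ.^ (n ℕ.∸ k) ℕ.* 2 ℕ.^ (n ℕ.∸ k) ℕ.* 16 ℕ.^ k
        ≡⟨ rotate (16 ℕ.^ (n ℕ.∸ k)) (2 ℕ.^ (n ℕ.∸ k)) (16 ℕ.^ k) ⟩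
      16 ℕ.^ (n ℕ.∸ k) ℕ.* 16 ℕ.^ k ℕ.* 2 ℕ.^ (n ℕ.∸ k)
        ≡⟨ cong (ℕ._* 2 ℕ.^ (n ℕ.∸ k)) (ℕ.^-distribˡ-+-* 16 (n ℕ.∸ k) k) ⟨
      16 ℕ.^ (n ℕ.∸ k ℕ.+ k) ℕ.* 2 ℕ.^ (n ℕ.∸ k)
        ≡⟨ cong (λ m → 16 ℕ.^ m ℕ.* 2 ℕ.^ (n ℕ.∸ k)) (ℕ.m∸n+n≡m k≤n) ⟩
      16 ℕ.^ n ℕ.* 2 ℕ.^ (n ℕ.∸ k) ∎
      where
      rotate : ∀ a b c → a ℕ.* b ℕ.* c ≡ a ℕ.* c ℕ.* b
      rotate = ℕ-Solver.solve-∀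
    powersᶻ : X * + (16 ℕ.^ k) ≡ + (16 ℕ.^ n) * Y
    powersᶻ = trans (sym (pos-* (32 ℕ.^ (n ℕ.∸ k)) (16 ℕ.^ k))) (trans (cong +_ powers) (pos-* (16 ℕ.^ n) (2 ℕ.^ (n ℕ.∸ k))))
    v = (2 ℕ.* k) C k
    numerator≡ : numerator n r k ≡ V * (V * 1ℤ) * F * X
    numerator≡ = trans (pos-* (v ℕ.^ 2 ℕ.* (k P r)) (32 ℕ.^ (n ℕ.∸ k)))
      (cong (_* X) (trans (pos-* (v ℕ.^ 2) (k P r)) (cong (_* F) (trans (pos-* v (v ℕ.* 1)) (cong (V *_) (pos-* v 1))))))
    pull : ∀ V F X Z Y s B → V * (V * 1ℤ) * F * X - Z * (s * Y * (B * V) * F) ≡ V * F * X * V - V * F * s * B * (Z * Y)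
    pull = solve-∀
    push : ∀ V F X W s B → V * F * X * V - V * F * s * B * (X * W) ≡ V * F * X * (V - s * W * B)
    push = solve-∀
    difference : numerator n r k - + (16 ℕ.^ n) * (coeff n k * F) ≡ V * F * X * (V - s * + (16 ℕ.^ k) * B)
    difference = begin
      numerator n r k - + (16 ℕ.^ n) * (coeff n k * F)
        ≡⟨ cong (_- + (16 ℕ.^ n) * (coeff n k * F)) numerator≡ ⟩
      V * (V * 1ℤ) * F * X - + (16 ℕ.^ n) * (s * Y * (B * V) * F)
        ≡⟨ pull V F X (+ (16 ℕ.^ n)) Y s B ⟩
      V * F * X * V - V * F * s * B * (+ (16 ℕ.^ n) * Y)
        ≡⟨ cong (λ x → V * F * X * V - V * F * s * B * x) powersᶻ ⟨
      V * F * X * V - V * F * s * B * (X * + (16 ℕ.^ k))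
        ≡⟨ push V F X (+ (16 ℕ.^ k)) s B ⟩
      V * F * X * (V - s * + (16 ℕ.^ k) * B) ∎

  ∑-congruent : ∀ {d} m {f g} → (∀ k → k ℕ.≤ m → d ∣ f k - g k) → d ∣ ∑ m f - ∑ m g
  ∑-congruent zero    d∣ = d∣ 0 ℕ.≤-refl
  ∑-congruent {d} (suc m) {f} {g} d∣ =
    subst (d ∣_) (interchange (∑ m f) (∑ m g) (f (suc m)) (g (suc m)))
      (∣m∣n⇒∣m+n (∑-congruent m λ k k≤m → d∣ k (ℕ.m≤n⇒m≤1+n k≤m)) (d∣ (suc m) ℕ.≤-refl))
    where
    interchange : ∀ a b c d → a - b + (c - d) ≡ a + c - (b + d)
    interchange = solve-∀

  ∑numerator≡derivative : ∀ n r → Prime (suc (2 ℕ.* n)) →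
    + (suc (2 ℕ.* n) ℕ.^ 2) ∣ ∑ n (numerator n r) - + (16 ℕ.^ n) * derivative n r
  ∑numerator≡derivative n r p-prime =
    subst (λ x → + (suc (2 ℕ.* n) ℕ.^ 2) ∣ ∑ n (numerator n r) - x) (∑-*ˡ n (+ (16 ℕ.^ n)) (λ k → coeff n k * falling k r))
      (∑-congruent n λ k → numerator≡coeff n r k p-prime)

  -- Fractions and congruences between them.

  /-≡ : ∀ i j d e .{{_ : ℕ.NonZero d}} .{{_ : ℕ.NonZero e}} → i * + e ≡ j * + d → i / d ≡ j / e
  /-≡ i j (suc d) (suc e) eq = ℚ.fromℚᵘ-cong {mkℚᵘ i d} {mkℚᵘ j e} (*≡* eq)

  /-+ : ∀ i j d .{{_ : ℕ.NonZero d}} → i / d ℚ.+ j / d ≡ (i + j) / d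
  /-+ i j (suc d) = ℚ.toℚᵘ-injective $ begin
    toℚᵘ (i / suc d ℚ.+ j / suc d)          ≈⟨ ℚ.toℚᵘ-homo-+ (i / suc d) (j / suc d) ⟩
    toℚᵘ (i / suc d) ℚᵘ.+ toℚᵘ (j / suc d)  ≈⟨ ℚᵘ.+-cong (ℚ.toℚᵘ-fromℚᵘ (mkℚᵘ i d)) (ℚ.toℚᵘ-fromℚᵘ (mkℚᵘ j d)) ⟩
    mkℚᵘ i d ℚᵘ.+ mkℚᵘ j d                  ≈⟨ *≡* (trans (distrib i j (+ suc d))
        (cong ((i + j) *_) (sym (pos-* (suc d) (suc d))))) ⟩
    mkℚᵘ (i + j) d                          ≈⟨ ℚ.toℚᵘ-fromℚᵘ (mkℚᵘ (i + j) d) ⟨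
    toℚᵘ ((i + j) / suc d)                  ∎
    where
    open ℚᵘ.≃-Reasoning
    distrib : ∀ i j d → (i * d + j * d) * d ≡ (i + j) * (d * d)
    distrib = solve-∀

  -- Reduces to `/-+` by writing i as (i - j) + j and cancelling `j / d`.
  /-- : ∀ i j d .{{_ : ℕ.NonZero d}} → i / d ℚ.- j / d ≡ (i - j) / d
  /-- i j d = begin
    i / d ℚ.- j / d                       ≡⟨ cong (λ x → x / d ℚ.- j / d) (restore i j) ⟩
    (i - j + j) / d ℚ.- j / d             ≡⟨ cong (ℚ._- j / d) (/-+ (i - j) j d) ⟨
    (i - j) / d ℚ.+ j / d ℚ.- j / d       ≡⟨ ℚ.+-assoc ((i - j) / d) (j / d) (ℚ.- (j / d)) ⟩
    (i - j) / d ℚ.+ (j / d ℚ.- j / d)     ≡⟨ cong ((i - j) / d ℚ.+_) (ℚ.+-inverseʳ (j / d)) ⟩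
    (i - j) / d ℚ.+ 0ℚ                    ≡⟨ ℚ.+-identityʳ ((i - j) / d) ⟩
    (i - j) / d                           ∎
    where
    open ≡-Reasoning
    restore : ∀ i j → i ≡ i - j + j
    restore = solve-∀

  ↧ₙ-∣ : ∀ i d .{{_ : ℕ.NonZero d}} → ↧ₙ (i / d) ℕ.∣ d
  ↧ₙ-∣ i d = ∣⇒∣ᵤ {+ (↧ₙ (i / d))} {+ d} (subst (+ (↧ₙ (i / d)) ∣_) (ℚ.↧-/ i d) (∣m⇒∣m*n (gcd i (+ d)) ∣-refl))

  -- Reduced denominators divide d. The difference i - j is the reduced numerator times g, and g
  -- divides d, so g is prime to p^e and cancels.
  Congruent-/ : ∀ {p e i j d} .{{_ : ℕ.NonZero d}} → Coprime d p → + (p ℕ.^ e) ∣ i - j → Congruent p e (i / d) (j / d)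
  Congruent-/ {p} {e} {i} {j} {d} d⊥p pᵉ∣ = congruent (reduced i) (reduced j)
    (subst (λ x → p ℕ.^ e ℕ.∣ ℤ.∣ ↥ x ∣) (sym (/-- i j d))
        (∣⇒∣ᵤ (∣ᶻ-cancel-coprime g pᵉ⊥g (subst (+ (p ℕ.^ e) ∣_) i-j≡ pᵉ∣))))
    where
    reduced : ∀ i → Coprime (↧ₙ (i / d)) p
    reduced i (c∣↧ , c∣p) = d⊥p (ℕ.∣-trans c∣↧ (↧ₙ-∣ i d) , c∣p)
    g = ℤ.∣ gcd (i - j) (+ d) ∣
    pᵉ⊥g : Coprime (p ℕ.^ e) g
    pᵉ⊥g = Coprime.sym (coprime-^ e (λ (c∣g , c∣p) → d⊥p (ℕ.∣-trans c∣g (gcd[i,j]∣j (i - j) (+ d)) , c∣p)))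
    i-j≡ : i - j ≡ + g * ↥ ((i - j) / d)
    i-j≡ = trans (sym (ℚ.↥-/ (i - j) d)) (ℤ.*-comm (↥ ((i - j) / d)) (+ g))

  -- The sum as a rational number.

  _/32^_ : ℤ → ℕ → ℚ
  i /32^ n = (i / (32 ℕ.^ n)) {{ℕ.m^n≢0 32 n}}

  _/2^_ : ℤ → ℕ → ℚ
  i /2^ n = (i / (2 ℕ.^ n)) {{ℕ.m^n≢0 2 n}}

  summand≡ : ∀ n r k → k ℕ.≤ n → summand r k ≡ numerator n r k /32^ n
  summand≡ n r k k≤n = /-≡ (+ x) (numerator n r k) (32 ℕ.^ k) (32 ℕ.^ n) {{ℕ.m^n≢0 32 k}} {{ℕ.m^n≢0 32 n}} $ begin
    + x * + (32 ℕ.^ n)                                ≡⟨ pos-* x (32 ℕ.^ n) ⟨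
    + (x ℕ.* 32 ℕ.^ n)                                ≡⟨ cong (λ m → + (x ℕ.* 32 ℕ.^ m)) (ℕ.m∸n+n≡m k≤n) ⟨
    + (x ℕ.* 32 ℕ.^ (n ℕ.∸ k ℕ.+ k))                  ≡⟨ cong (λ y → + (x ℕ.* y)) (ℕ.^-distribˡ-+-* 32 (n ℕ.∸ k) k) ⟩
    + (x ℕ.* (32 ℕ.^ (n ℕ.∸ k) ℕ.* 32 ℕ.^ k))         ≡⟨ cong +_ (ℕ.*-assoc x (32 ℕ.^ (n ℕ.∸ k)) (32 ℕ.^ k)) ⟨
    + (x ℕ.* 32 ℕ.^ (n ℕ.∸ k) ℕ.* 32 ℕ.^ k)           ≡⟨ pos-* (x ℕ.* 32 ℕ.^ (n ℕ.∸ k)) (32 ℕ.^ k) ⟩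
    numerator n r k * + (32 ℕ.^ k)                    ∎
    where
    open ≡-Reasoning
    x = ((2 ℕ.* k) C k) ℕ.^ 2 ℕ.* (k P r)

  ∑₀-/ : ∀ {d} .{{_ : ℕ.NonZero d}} m {f g} → (∀ k → k ℕ.≤ m → f k ≡ g k / d) → ∑₀ m f ≡ ∑ m g / d
  ∑₀-/ zero            eq = eq 0 ℕ.≤-refl
  ∑₀-/ {d} (suc m) {f} {g} eq =
    trans (cong₂ ℚ._+_ (∑₀-/ m λ k k≤m → eq k (ℕ.m≤n⇒m≤1+n k≤m)) (eq (suc m) ℕ.≤-refl)) (/-+ (∑ m g) (g (suc m)) d)

  ∑₀-summand : ∀ n r → ∑₀ n (summand r) ≡ ∑ n (numerator n r) /32^ n
  ∑₀-summand n r = ∑₀-/ {{ℕ.m^n≢0 32 n}} n (summand≡ n r)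

  -- Over the denominator 32ⁿ the numerators add up to 16ⁿ `derivative n r` modulo p², and 16ⁿ / 32ⁿ
  -- = 1 / 2ⁿ.
  ∑₀-congruent-derivative : ∀ n r → 1 ℕ.≤ n → Prime (suc (2 ℕ.* n)) →
    Congruent (suc (2 ℕ.* n)) 2 (∑₀ n (summand r)) (derivative n r /2^ n)
  ∑₀-congruent-derivative n r 1≤n p-prime =
    subst₂ (Congruent (suc (2 ℕ.* n)) 2) (sym (∑₀-summand n r))
        (/-≡ (+ (16 ℕ.^ n) * derivative n r) (derivative n r) (32 ℕ.^ n) (2 ℕ.^ n)
        {{ℕ.m^n≢0 32 n}} {{ℕ.m^n≢0 2 n}} cross)
      (Congruent-/ {i = ∑ n (numerator n r)} {+ (16 ℕ.^ n) * derivative n r} {{ℕ.m^n≢0 32 n}}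
          (Coprime.sym (coprime-^ n p⊥32))
          (∑numerator≡derivative n r p-prime))
    where
    p⊥32 : Coprime (suc (2 ℕ.* n)) 32
    -- 32 = 2⁵, and 2 < p because 1 ≤ n.
    p⊥32 = coprime-^ 5 (prime⇒coprime p-prime (s≤s (ℕ.*-monoʳ-≤ 2 1≤n)))
    swap : ∀ a b c → a * b * c ≡ b * (a * c)
    swap = solve-∀
    cross : + (16 ℕ.^ n) * derivative n r * + (2 ℕ.^ n) ≡ derivative n r * + (32 ℕ.^ n)
    cross = trans (swap (+ (16 ℕ.^ n)) (derivative n r) (+ (2 ℕ.^ n)))
      (cong (derivative n r *_) (trans (sym (pos-* (16 ℕ.^ n) (2 ℕ.^ n))) (cong +_ (sym (^-distribʳ-* n 16 2)))))

  -- Parity and the two cases.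

  odd⇒1+2* : ∀ m → ¬ 2 ℕ.∣ m → ∃ λ n → m ≡ suc (2 ℕ.* n)
  odd⇒1+2* m 2∤m with m ℕ.% 2 | ℕ.m≡m%n+[m/n]*n m 2 | ℕ.m%n<n m 2
  ... | 0           | eq | _                 = contradiction (ℕ.divides (m ℕ./ 2) eq) 2∤m
  ... | 1           | eq | _                 = m ℕ./ 2 , trans eq (cong suc (ℕ.*-comm (m ℕ./ 2) 2))
  ... | suc (suc _) | _  | s≤s (s≤s ())

  double-/2 : ∀ n → 2 ℕ.* n ℕ./ 2 ≡ n
  double-/2 n = trans (cong (ℕ._/ 2) (ℕ.*-comm 2 n)) (ℕ.m*n/n≡m n 2)

  -- Serves both cases: with p + 1 for n it yields the index equation of `derivative-odd`, with p -
  -- 1 that of `derivative-even`.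
  halve : ∀ {n m r} q → n ≡ 2 ℕ.* m → 2 ℕ.* r ℕ.≤ n → n ℕ.∸ 2 ℕ.* r ≡ q ℕ.* 4 → r ℕ.+ 2 ℕ.* q ≡ m
  halve {n} {m} {r} q n≡2m 2r≤n eq = ℕ.*-cancelˡ-≡ _ _ 2 $ begin
    2 ℕ.* (r ℕ.+ 2 ℕ.* q)            ≡⟨ expand r q ⟩
    2 ℕ.* r ℕ.+ q ℕ.* 4              ≡⟨ cong (2 ℕ.* r ℕ.+_) eq ⟨
    2 ℕ.* r ℕ.+ (n ℕ.∸ 2 ℕ.* r)      ≡⟨ ℕ.m+[n∸m]≡n 2r≤n ⟩
    n                                ≡⟨ n≡2m ⟩
    2 ℕ.* m                          ∎
    where
    open ≡-Reasoning
    expand : ∀ r q → 2 ℕ.* (r ℕ.+ 2 ℕ.* q) ≡ 2 ℕ.* r ℕ.+ q ℕ.* 4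
    expand = ℕ-Solver.solve-∀

  -- The indices h, a′ and b are variables tied by equations because in `rhs` they are quotients
  -- inside a denominator that carries a nonzero proof; matching on `refl` replaces them all at
  -- once.
  derivative-/-even : ∀ {n} a r → r ℕ.+ 2 ℕ.* a ≡ n → ∀ {h b a′} .{{_ : ℕ.NonZero (2 ℕ.^ h ℕ.* (a′ ! ℕ.* b !))}} →
    h ≡ n → a′ ≡ a → b ≡ a ℕ.+ r →
    derivative n r /2^ n ≡ (-1ℤ ^ b * + ((h ℕ.+ r) !)) / (2 ℕ.^ h ℕ.* (a′ ! ℕ.* b !))
  derivative-/-even {n} a r eq refl refl refl =
      /-≡ (derivative n r) (-1ℤ ^ (a ℕ.+ r) * + ((n ℕ.+ r) !)) (2 ℕ.^ n) _
      {{ℕ.m^n≢0 2 n}} $ begin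
    derivative n r * + (2 ℕ.^ n ℕ.* (a ! ℕ.* b !))
      ≡⟨ cong (derivative n r *_) (trans (pos-* (2 ℕ.^ n) (a ! ℕ.* b !)) (cong (+ (2 ℕ.^ n) *_) (pos-* (a !) (b !)))) ⟩
    derivative n r * (+ (2 ℕ.^ n) * (+ (a !) * + (b !)))
      ≡⟨ rotate (derivative n r) (+ (2 ℕ.^ n)) (+ (a !) * + (b !)) ⟩
    derivative n r * (+ (a !) * + (b !)) * + (2 ℕ.^ n)
      ≡⟨ cong (_* + (2 ℕ.^ n)) (derivative-even a r eq) ⟩
    -1ℤ ^ b * + ((n ℕ.+ r) !) * + (2 ℕ.^ n) ∎
    where
    open ≡-Reasoning
    b = a ℕ.+ r
    rotate : ∀ x y z → x * (y * z) ≡ x * z * y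
    rotate = solve-∀

  module _ (n r : ℕ) (p-prime : Prime (suc (2 ℕ.* n))) (1≤r : 1 ℕ.≤ r) (r≤h : r ℕ.≤ 2 ℕ.* n ℕ./ 2) where

    private
      p = suc (2 ℕ.* n)

      r≤n : r ℕ.≤ n
      r≤n = subst (r ℕ.≤_) (double-/2 n) r≤h

      2r≤2n : 2 ℕ.* r ℕ.≤ 2 ℕ.* n
      2r≤2n = ℕ.*-monoʳ-≤ 2 r≤n

      lhs≡derivative : Congruent p 2 (lhs p r) (derivative n r /2^ n)
      lhs≡derivative = subst (λ h → Congruent p 2 (∑₀ h (summand r)) (derivative n r /2^ n))
        (sym (double-/2 n)) (∑₀-congruent-derivative n r (ℕ.≤-trans 1≤r r≤n) p-prime)

    -- From p + 1 - 2r = 4q follows r + 2q = n + 1, where the derivative vanishes by parity.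
    lhs≡0 : 4 ℕ.∣ (p ℕ.+ 1 ℕ.∸ 2 ℕ.* r) → Congruent p 2 (lhs p r) 0ℚ
    lhs≡0 (ℕ.divides q eq) = subst (Congruent p 2 (lhs p r))
      (trans (cong (_/2^ n) (derivative-odd {n} q r (halve {p ℕ.+ 1} {suc n} {r} q (double n) 2r≤p+1 eq)))
          (ℚ.0/n≡0 (2 ℕ.^ n) {{ℕ.m^n≢0 2 n}}))
      lhs≡derivative
      where
      double : ∀ n → suc (2 ℕ.* n) ℕ.+ 1 ≡ 2 ℕ.* suc n
      double = ℕ-Solver.solve-∀
      -- Ensures that the truncated subtraction in p + 1 - 2r is exact.
      2r≤p+1 : 2 ℕ.* r ℕ.≤ p ℕ.+ 1
      2r≤p+1 = ℕ.≤-trans 2r≤2n (ℕ.≤-trans (ℕ.n≤1+n (2 ℕ.* n)) (ℕ.m≤m+n p 1))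

    -- From p - 1 - 2r = 4q follows r + 2q = n, hence p - 1 + 2r = 4 (q + r), and the two quotients
    -- in `rhs` are q and q + r.
    lhs≡rhs : 4 ℕ.∣ (p ℕ.∸ 1 ℕ.∸ 2 ℕ.* r) → Congruent p 2 (lhs p r) (rhs p r)
    lhs≡rhs (ℕ.divides q eq) = subst (Congruent p 2 (lhs p r))
      (derivative-/-even q r n≡ (double-/2 n) a≡ b≡)
      lhs≡derivative
      where
      n≡ : r ℕ.+ 2 ℕ.* q ≡ n
      n≡ = halve {2 ℕ.* n} {n} {r} q refl 2r≤2n eq
      a≡ : (2 ℕ.* n ℕ.∸ 2 ℕ.* r) ℕ./ 4 ≡ q
      a≡ = trans (cong (ℕ._/ 4) eq) (ℕ.m*n/n≡m q 4)
      quadruple : ∀ q r → 2 ℕ.* (r ℕ.+ 2 ℕ.* q) ℕ.+ 2 ℕ.* r ≡ (q ℕ.+ r) ℕ.* 4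
      quadruple = ℕ-Solver.solve-∀
      b≡ : (2 ℕ.* n ℕ.+ 2 ℕ.* r) ℕ./ 4 ≡ q ℕ.+ r
      b≡ = trans (cong (λ m → (2 ℕ.* m ℕ.+ 2 ℕ.* r) ℕ./ 4) (sym n≡))
          (trans (cong (ℕ._/ 4) (quadruple q r)) (ℕ.m*n/n≡m (q ℕ.+ r) 4))
      instance
        _ = ℕ.m*n≢0 (2 ℕ.^ (2 ℕ.* n ℕ./ 2)) (((2 ℕ.* n ℕ.∸ 2 ℕ.* r) ℕ./ 4) ! ℕ.* ((2 ℕ.* n ℕ.+ 2 ℕ.* r) ℕ./ 4) !)
              {{ℕ.m^n≢0 2 (2 ℕ.* n ℕ./ 2)}}
                  {{((2 ℕ.* n ℕ.∸ 2 ℕ.* r) ℕ./ 4) ℕ.!* ((2 ℕ.* n ℕ.+ 2 ℕ.* r) ℕ./ 4) !≢0}}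

open LegendreAtZero using (odd⇒1+2*; lhs≡0; lhs≡rhs)

open import Data.Nat.Base using (ℕ; _+_; _*_; _∸_; _/_; _≤_)
open import Data.Nat.Divisibility using (_∣_)
open import Data.Nat.Primality using (Prime)
open import Data.Product.Base using (_×_; _,_)
open import Data.Rational.Base using (0ℚ)
open import Relation.Binary.PropositionalEquality.Core using (refl)
open import Relation.Nullary.Negation using (¬_)

theorem2p3 : (p r : ℕ) → Prime p → ¬ (2 ∣ p) → 1 ≤ r → r ≤ (p ∸ 1) / 2 →
    (4 ∣ (p + 1 ∸ 2 * r) → Congruent p 2 (lhs p r) 0ℚ) ×
    (4 ∣ (p ∸ 1 ∸ 2 * r) → Congruent p 2 (lhs p r) (rhs p r))
theorem2p3 p r p-prime 2∤p 1≤r r≤h with odd⇒1+2* p 2∤p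
-- Once p is 2n + 1, `p ∸ 1` computes to `2 * n`.
... | n , refl = lhs≡0 n r p-prime 1≤r r≤h , lhs≡rhs n r p-prime 1≤r r≤h
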